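{- Let $i\neq j$ in $\{0,1,2,3\}$ and let $G\in\varepsilon_{ij}$ be a block (a 2-connected graph). Then $G$ contains a cycle of type $i$ and a cycle of type $j$ that intersect, i.e. whose common part is a path with at least one edge.
   Context: All graphs are finite, simple and connected. An Euler graph is a connected graph all of whose nodes have even degree. A cycle of length $n$ is of type $i$ if $n\equiv i\pmod 4$. For distinct $i,j\in\{0,1,2,3\}$, $\varepsilon_{ij}$ is the class of Euler graphs in which every cycle has length $\equiv i$ or $\equiv j\pmod 4$ and which contain at least one cycle of each of the types $i$ and $j$. Two cycles are said to intersect if their intersection is a path $P_t$ with $t>0$ edges. -}

module Defs where

open import Data.Nat using (ℕ; _≤_; _%_)
open import Data.Nat.Divisibility using (_∣_)
open import Data.Fin using (Fin; toℕ)
open import Data.Bool using (Bool; true; false; T)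
open import Data.List using (List; []; _∷_; _++_; [_]; length; filterᵇ; allFin)
open import Data.List.Membership.Propositional using (_∈_)
open import Data.List.Relation.Unary.All using (All)
open import Data.List.Relation.Unary.Linked using (Linked)
open import Data.List.Relation.Unary.Unique.Propositional using (Unique)
open import Data.Product using (Σ; ∃; _×_; _,_)
open import Data.Sum using (_⊎_)
open import Relation.Binary.PropositionalEquality using (_≡_; _≢_)
open import Function.Bundles using (_⇔_)

record Graph (n : ℕ) : Set where
  field
    adj    : Fin n → Fin n → Bool
    sym    : ∀ x y → adj x y ≡ adj y x
    irrefl : ∀ x → adj x x ≡ false

module _ {n : ℕ} (G : Graph n) where
  open Graph G

  E : Fin n → Fin n → Set
  E x y = T (adj x y)

  degree : Fin n → ℕ
  degree x = length (filterᵇ (adj x) (allFin n))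

  data Walk : Fin n → Fin n → List (Fin n) → Set where
    stay : ∀ {x} → Walk x x [ x ]
    step : ∀ {x y z ws} → E x y → Walk y z ws → Walk x z (x ∷ ws)

  Connected : Set
  Connected = ∀ x y → ∃ λ ws → Walk x y ws

  TwoConnected : Set
  TwoConnected = 3 ≤ n × Connected ×
    (∀ v x y → x ≢ v → y ≢ v → ∃ λ ws → Walk x y ws × All (_≢ v) ws)

  EulerGraph : Set
  EulerGraph = Connected × (∀ x → 2 ∣ degree x)

  record Cycle : Set where
    constructor cycle
    field
      v₀    : Fin n
      rest  : List (Fin n)
      long  : 2 ≤ length rest
      uniq  : Unique (v₀ ∷ rest)
      edges : Linked E (v₀ ∷ rest ++ [ v₀ ])

  verts : Cycle → List (Fin n)
  verts c = Cycle.v₀ c ∷ Cycle.rest c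

  len : Cycle → ℕ
  len c = length (verts c)

data Consec {A : Set} : List A → A → A → Set where
  here  : ∀ {x y xs} → Consec (x ∷ y ∷ xs) x y
  there : ∀ {x a b xs} → Consec xs a b → Consec (x ∷ xs) a b

PathEdge : {A : Set} → List A → A → A → Set
PathEdge p x y = Consec p x y ⊎ Consec p y x

module _ {n : ℕ} {G : Graph n} where

  CycleEdge : Cycle G → Fin n → Fin n → Set
  CycleEdge c x y = PathEdge (Cycle.v₀ c ∷ Cycle.rest c ++ [ Cycle.v₀ c ]) x y

  HasType : Fin 4 → Cycle G → Set
  HasType i c = len G c % 4 ≡ toℕ i

  Intersect : Cycle G → Cycle G → Set
  Intersect c d = Σ (List (Fin n)) λ p →
      2 ≤ length p × Unique p
    × (∀ v → ((v ∈ verts G c × v ∈ verts G d) ⇔ v ∈ p))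
    × (∀ x y → ((CycleEdge c x y × CycleEdge d x y) ⇔ PathEdge p x y))

InEps : {n : ℕ} → Fin 4 → Fin 4 → Graph n → Set
InEps i j G = EulerGraph G
  × (∀ (c : Cycle G) → HasType i c ⊎ HasType j c)
  × (Σ (Cycle G) (HasType i))
  × (Σ (Cycle G) (HasType j))

{-# OPTIONS --safe #-}

-- The three cycles of a theta graph pairwise intersect, so it suffices to join a
-- cycle of type i to a cycle of type j by a chain of cycles in which neighbours lie
-- in a common theta graph: the type has to change somewhere along the chain.
--
-- Cycles sharing an edge are joined by such a chain. Let C and D start with the same
-- path P, and let b be the first vertex of D after P that also lies on C − P.
-- Rerouting C along D between the end of P and b replaces one path of a theta graph
-- by another, and the new cycle agrees with D at least up to b. If there is no such
-- b, then C ∪ D is itself a theta graph.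
--
-- Cycles sharing a vertex v, with edges vx and vy: a path from x to y avoiding v
-- closes up to a cycle containing both edges. Connectedness gives the rest.

module Submission where

open import Defs
open import Data.Nat using (ℕ; suc; _≤_; _<_; _%_; z≤n; s≤s; s≤s⁻¹; _+_)
open import Data.Nat.Properties using (≤-trans; +-mono-≤; +-monoˡ-≤; module ≤-Reasoning)
open import Data.Nat.Induction using (<-wellFounded)
open import Data.Fin using (Fin; toℕ; _≟_)
open import Data.Fin.Properties using (toℕ-injective)
open import Data.Bool using (T)
open import Data.List using (List; []; _∷_; _++_; [_]; length; reverse)
open import Data.List.Properties using (++-assoc; ++-identityʳ; length-++; length-reverse; length-++-comm; length-++-≤ˡ; length-++-≤ʳ; unfold-reverse)
open import Data.List.Membership.Propositional using (_∈_; _∉_)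
open import Data.List.Membership.Propositional.Properties using (∈-++⁺ˡ; ∈-++⁺ʳ; ∈-++⁻; ∈-∃++)
open import Data.List.Relation.Binary.Disjoint.Propositional using (Disjoint)
open import Data.List.Relation.Binary.Permutation.Propositional using (_↭_; ↭⇒↭ₛ; ↭-sym)
open import Data.List.Relation.Binary.Permutation.Propositional.Properties using (++-comm; ↭-reverse; ↭-length; ∈-resp-↭)
import Data.List.Relation.Binary.Permutation.Setoid.Properties as Permutationₛ
open import Data.List.Relation.Binary.Subset.Propositional using (_⊆_)
open import Data.List.Relation.Unary.All as All using ([]; _∷_)
open import Data.List.Relation.Unary.All.Properties as All using (¬Any⇒All¬; All¬⇒¬Any)
open import Data.List.Relation.Unary.AllPairs using ([]; _∷_)
open import Data.List.Relation.Unary.Any using (here; there)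
open import Data.List.Relation.Unary.Linked using (Linked; [-]; _∷_)
open import Data.List.Relation.Unary.Unique.Propositional using (Unique)
import Data.List.Relation.Unary.Unique.Propositional.Properties as Unique
open import Data.Product using (Σ; ∃; ∃₂; _×_; _,_; proj₁; proj₂; swap)
open import Data.Sum as Sum using (_⊎_; inj₁; inj₂)
open import Function using (_∘_; mk⇔)
open import Induction.WellFounded using (Acc; acc)
open import Relation.Binary.Construct.Closure.ReflexiveTransitive using (Star; ε; _◅_; _◅◅_)
open import Relation.Binary.PropositionalEquality using (_≡_; _≢_; refl; sym; trans; cong; subst; subst₂; setoid; module ≡-Reasoning)
open import Relation.Nullary using (yes; no; contradiction)

-- Duplicate-free lists and consecutive entries.

module _ {A : Set} where

  Unique-resp-↭ : {xs ys : List A} → xs ↭ ys → Unique xs → Unique ys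
  Unique-resp-↭ p = Permutationₛ.Unique-resp-↭ (setoid A) (↭⇒↭ₛ p)

  Unique-++⁻ : ∀ xs {ys : List A} → Unique (xs ++ ys) → Unique xs × Unique ys × Disjoint xs ys
  Unique-++⁻ []       u = [] , u , λ ()
  Unique-++⁻ (x ∷ xs) (x≢ ∷ u) with Unique-++⁻ xs u
  ... | uxs , uys , dis = All.++⁻ˡ xs x≢ ∷ uxs , uys , λ
    { (here refl , v∈ys) → All¬⇒¬Any (All.++⁻ʳ xs x≢) v∈ys
    ; (there v∈xs , v∈ys) → dis (v∈xs , v∈ys) }

  Consec-∈ : ∀ {xs : List A} {x y} → Consec xs x y → x ∈ xs × y ∈ xs
  Consec-∈ here      = here refl , there (here refl)
  Consec-∈ (there c) with Consec-∈ c
  ... | x∈ , y∈ = there x∈ , there y∈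

  Consec-++⁺ˡ : ∀ {xs ys : List A} {x y} → Consec xs x y → Consec (xs ++ ys) x y
  Consec-++⁺ˡ here      = here
  Consec-++⁺ˡ (there c) = there (Consec-++⁺ˡ c)

  -- The witness `a` is the last entry of `b ∷ xs`, so a pair straddling the junction falls under
  -- the second alternative.
  Consec-++⁻ : ∀ b xs {ys : List A} → ∃ λ a →
    ∀ {x y} → Consec (b ∷ xs ++ ys) x y → Consec (b ∷ xs) x y ⊎ Consec (a ∷ ys) x y
  Consec-++⁻ b []       = b , inj₂
  Consec-++⁻ b (c ∷ xs) with Consec-++⁻ c xs
  ... | a , split = a , λ
    { here → inj₁ here
    ; (there q) → Sum.map₁ there (split q) }

  -- The nonempty middle keeps the two ends from standing next to each other.
  Consec-meets : ∀ {a b s} {ss : List A} {x y} →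
    Consec (a ∷ (s ∷ ss) ++ [ b ]) x y → x ∈ s ∷ ss ⊎ y ∈ s ∷ ss
  Consec-meets here = inj₂ (here refl)
  Consec-meets {ss = []}     (there here) = inj₁ (here refl)
  Consec-meets {ss = []}     (there (there (there ())))
  Consec-meets {ss = _ ∷ ss} (there c) = Sum.map there there (Consec-meets c)

  closed : A → List A → List A
  closed b xs = b ∷ xs ++ [ b ]

  Consec-closed-∈ : ∀ {b} {xs : List A} {x y} → Consec (closed b xs) x y → x ∈ b ∷ xs × y ∈ b ∷ xs
  Consec-closed-∈ {b} {xs} q = drop-last (proj₁ (Consec-∈ q)) , drop-last (proj₂ (Consec-∈ q))
    where
    drop-last : ∀ {v} → v ∈ closed b xs → v ∈ b ∷ xs
    drop-last v∈ with ∈-++⁻ (b ∷ xs) v∈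
    ... | inj₁ v∈xs        = v∈xs
    ... | inj₂ (here refl) = here refl

  PathEdge-closed-∈ : ∀ {b} {xs : List A} {x y} → PathEdge (closed b xs) x y → x ∈ b ∷ xs × y ∈ b ∷ xs
  PathEdge-closed-∈ (inj₁ q) = Consec-closed-∈ q
  PathEdge-closed-∈ (inj₂ q) = swap (Consec-closed-∈ q)

  PathEdge-closed⁺ : ∀ {b p s} {x y : A} → PathEdge (b ∷ p) x y → PathEdge (closed b (p ++ s)) x y
  PathEdge-closed⁺ = Sum.map extend extend
    where
    extend : ∀ {b p s} {x y : A} → Consec (b ∷ p) x y → Consec (closed b (p ++ s)) x y
    extend q = Consec-++⁺ˡ (Consec-++⁺ˡ q)

  -- Every edge of the closed list outside `b ∷ p` has an endpoint in `s ∷ ss`. With an empty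
  -- segment this could fail for the closing edge, which would join the two ends of `b ∷ p`.
  PathEdge-closed⁻ : ∀ {b} p {s ss} {x y : A} → x ∉ s ∷ ss → y ∉ s ∷ ss →
    PathEdge (closed b (p ++ s ∷ ss)) x y → PathEdge (b ∷ p) x y
  PathEdge-closed⁻ {b} p {s} {ss} x∉ y∉ = Sum.map (restrict x∉ y∉) (restrict y∉ x∉)
    where
    restrict : ∀ {x y} → x ∉ s ∷ ss → y ∉ s ∷ ss →
      Consec (closed b (p ++ s ∷ ss)) x y → Consec (b ∷ p) x y
    restrict x∉ y∉ q rewrite ++-assoc p (s ∷ ss) [ b ] with proj₂ (Consec-++⁻ b p) q
    ... | inj₁ q′ = q′
    ... | inj₂ q′ with Consec-meets q′
    ... | inj₁ x∈ = contradiction x∈ x∉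
    ... | inj₂ y∈ = contradiction y∈ y∉

-- Splitting a list at its first entry in another list.

module _ {n : ℕ} where

  open import Data.List.Membership.DecPropositional (_≟_ {n}) using (_∈?_)

  data FirstCommon (xs ys : List (Fin n)) : Set where
    none  : Disjoint xs ys → FirstCommon xs ys
    first : ∀ as b cs → xs ≡ as ++ b ∷ cs → Disjoint as ys → b ∈ ys → FirstCommon xs ys

  firstCommon : ∀ xs ys → FirstCommon xs ys
  firstCommon []       ys = none λ ()
  firstCommon (x ∷ xs) ys with x ∈? ys | firstCommon xs ys
  ... | yes x∈ | _ = first [] x xs refl (λ ()) x∈
  ... | no x∉ | none dis = none λ
    { (here refl , v∈) → x∉ v∈
    ; (there v∈xs , v∈) → dis (v∈xs , v∈) }
  ... | no x∉ | first as b cs refl dis b∈ = first (x ∷ as) b cs refl (λ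
    { (here refl , v∈) → x∉ v∈
    ; (there v∈as , v∈) → dis (v∈as , v∈) }) b∈

-- Walks, simple paths and circuits.

module _ {n : ℕ} (G : Graph n) where

  open import Data.List.Membership.DecPropositional (_≟_ {n}) using (_∈?_)

  E-sym : ∀ {x y} → E G x y → E G y x
  E-sym {x} {y} = subst T (Graph.sym G x y)

  E⇒≢ : ∀ {x y} → E G x y → y ≢ x
  E⇒≢ {x} e refl = subst T (Graph.irrefl G x) e

  walk-nonempty : ∀ {x y xs} → Walk G x y xs → 1 ≤ length xs
  walk-nonempty stay       = s≤s z≤n
  walk-nonempty (step _ _) = s≤s z≤n

  walk-∷ : ∀ {x y xs} → Walk G x y xs → ∃ λ r → xs ≡ x ∷ r
  walk-∷ stay       = _ , refl
  walk-∷ (step _ _) = _ , refl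

  walk-head : ∀ {x y z xs} → Walk G x z (y ∷ xs) → x ≡ y
  walk-head stay       = refl
  walk-head (step _ _) = refl

  walk-++⁺ : ∀ {x u w z xs ys} → Walk G x u xs → E G u w → Walk G w z ys → Walk G x z (xs ++ ys)
  walk-++⁺ stay       e q = step e q
  walk-++⁺ (step f p) e q = step f (walk-++⁺ p e q)

  walk-++⁻ : ∀ {x w z} a xs {ys} → Walk G x z (a ∷ xs ++ w ∷ ys) →
    ∃ λ u → Walk G x u (a ∷ xs) × E G u w × Walk G w z (w ∷ ys)
  walk-++⁻ a []       (step e p) with refl ← walk-head p = _ , stay , e , p
  walk-++⁻ a (b ∷ xs) (step e p) with walk-++⁻ b xs p
  ... | u , q , f , r = u , step e q , f , r

  walk-reverse : ∀ {x y xs} → Walk G x y xs → Walk G y x (reverse xs)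
  walk-reverse stay = stay
  walk-reverse {xs = x ∷ xs} (step e p) rewrite unfold-reverse x xs =
    walk-++⁺ (walk-reverse p) (E-sym e) stay

  walk⇒linked : ∀ {x y z r} → Walk G x y (x ∷ r) → E G y z → Linked (E G) (x ∷ r ++ [ z ])
  walk⇒linked stay                   e = e ∷ [-]
  walk⇒linked (step f stay)          e = f ∷ walk⇒linked stay e
  walk⇒linked (step f p@(step _ _))  e = f ∷ walk⇒linked p e

  linked⇒walk : ∀ {x z} r → Linked (E G) (x ∷ r ++ [ z ]) → ∃ λ y → Walk G x y (x ∷ r) × E G y z
  linked⇒walk []      (e ∷ _) = _ , stay , e
  linked⇒walk (y ∷ r) (e ∷ l) with linked⇒walk r l
  ... | u , p , f = u , step e p , f

  simplePath : ∀ {x y ws} → Walk G x y ws → ∃ λ ps → Walk G x y ps × Unique ps × ps ⊆ ws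
  simplePath stay = _ , stay , [] ∷ [] , λ v∈ → v∈
  simplePath {x} (step e p) with simplePath p
  ... | ps , q , u , ps⊆ with x ∈? ps
  ... | no x∉ = x ∷ ps , step e q , ¬Any⇒All¬ _ x∉ ∷ u , λ
    { (here refl) → here refl
    ; (there v∈) → there (ps⊆ v∈) }
  -- Loop erasure: the path returns to `x`, so only its part from `x` on is kept.
  ... | yes x∈ with ∈-∃++ x∈
  ... | [] , bs , refl with refl ← walk-head q = _ , q , u , there ∘ ps⊆
  ... | a ∷ as , bs , refl with walk-++⁻ a as q
  ... | _ , _ , _ , r =
    x ∷ bs , r , proj₁ (proj₂ (Unique-++⁻ (a ∷ as) u)) , there ∘ ps⊆ ∘ ∈-++⁺ʳ (a ∷ as)

  -- The data of a `Cycle`, indexed by the vertex list so that cutting a cycle into paths becomes an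
  -- equation between lists.
  record Circuit (xs : List (Fin n)) : Set where
    constructor circuit
    field
      {start end} : Fin n
      walk    : Walk G start end xs
      closing : E G end start
      uniq    : Unique xs
      long    : 3 ≤ length xs

  open Circuit

  circuit-linked : ∀ {x r} → Circuit (x ∷ r) → Linked (E G) (closed x r)
  circuit-linked (circuit p e _ _) with refl ← walk-head p = walk⇒linked p e

  toCycle : ∀ {x r} → Circuit (x ∷ r) → Cycle G
  toCycle {x} {r} c = cycle x r (s≤s⁻¹ (long c)) (uniq c) (circuit-linked c)

  fromCycle : (c : Cycle G) → Circuit (verts G c)
  fromCycle (cycle x r l u es) with linked⇒walk r es
  ... | _ , p , e = circuit p e u (s≤s l)

  rotate : ∀ xs ys → Circuit (xs ++ ys) → Circuit (ys ++ xs)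
  rotate []       ys       c = subst Circuit (sym (++-identityʳ ys)) c
  rotate (x ∷ xs) []       c = subst Circuit (++-identityʳ (x ∷ xs)) c
  rotate (x ∷ xs) (y ∷ ys) (circuit p e u l) with walk-++⁻ x xs p
  -- The old closing edge `e` becomes the junction, and the old junction `f` closes the new circuit.
  ... | _ , q , f , r = circuit (walk-++⁺ r e q) f (Unique-resp-↭ comm u) (subst (3 ≤_) (↭-length comm) l)
    where comm = ++-comm (x ∷ xs) (y ∷ ys)

  rotateTo : ∀ {xs v} → Circuit xs → v ∈ xs →
    ∃ λ ys → Circuit (v ∷ ys) × xs ↭ v ∷ ys
  rotateTo c v∈ with ∈-∃++ v∈
  ... | as , bs , refl = bs ++ as , rotate as _ c , ++-comm as _

  -- Chains of intersecting cycles and theta graphs.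

  -- A relation on lengths only, so that rotating or reversing a cycle costs nothing.
  Linking : ℕ → ℕ → Set
  Linking k l = ∃₂ λ c d → len G c ≡ k × len G d ≡ l × Intersect c d

  -- The ears `s` and `s′` close the same path `b ∷ p` into two cycles. One ear may be empty, a
  -- single closing edge; if both were, the cycles would coincide and share that edge as well.
  ears-intersect : ∀ {b p} s s′ → 2 ≤ length (b ∷ p) →
    (c : Circuit (b ∷ p ++ s)) (d : Circuit (b ∷ p ++ s′)) →
    Disjoint s s′ → s ++ s′ ≢ [] → Intersect (toCycle c) (toCycle d)
  ears-intersect {b} {p} s s′ lp c d dis ne =
      b ∷ p , lp , proj₁ (Unique-++⁻ (b ∷ p) (uniq c))
    , (λ v → mk⇔ vert⁻ (λ v∈ → ∈-++⁺ˡ v∈ , ∈-++⁺ˡ v∈))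
    , (λ x y → mk⇔ (edge⁻ s s′ dis p#s p#s′ ne) λ q → PathEdge-closed⁺ q , PathEdge-closed⁺ q)
    where
    p#s = proj₂ (proj₂ (Unique-++⁻ (b ∷ p) (uniq c)))
    p#s′ = proj₂ (proj₂ (Unique-++⁻ (b ∷ p) (uniq d)))

    vert⁻ : ∀ {v} → v ∈ b ∷ p ++ s × v ∈ b ∷ p ++ s′ → v ∈ b ∷ p
    vert⁻ (v∈₁ , v∈₂) with ∈-++⁻ (b ∷ p) v∈₁ | ∈-++⁻ (b ∷ p) v∈₂
    ... | inj₁ v∈ | _       = v∈
    ... | inj₂ _  | inj₁ v∈ = v∈
    ... | inj₂ v∈s | inj₂ v∈s′ = contradiction (v∈s , v∈s′) dis

    avoid : ∀ {s s′ v} → Disjoint s s′ → Disjoint (b ∷ p) s → v ∈ b ∷ p ++ s′ → v ∉ s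
    avoid dis p#s v∈ v∈s with ∈-++⁻ (b ∷ p) v∈
    ... | inj₁ v∈p  = p#s (v∈p , v∈s)
    ... | inj₂ v∈s′ = dis (v∈s , v∈s′)

    -- A common edge is an edge of each cycle, so it has no endpoint in the other cycle's ear.
    -- Applied to a nonempty ear, this forces it onto the path.
    edge⁻ : ∀ s s′ → Disjoint s s′ → Disjoint (b ∷ p) s → Disjoint (b ∷ p) s′ → s ++ s′ ≢ [] → ∀ {x y} →
      PathEdge (closed b (p ++ s)) x y × PathEdge (closed b (p ++ s′)) x y → PathEdge (b ∷ p) x y
    edge⁻ []      []       _   _   _    ne _         = contradiction refl ne
    edge⁻ (_ ∷ _) _        dis p#s _    _  (q₁ , q₂) with PathEdge-closed-∈ q₂
    ... | x∈ , y∈ = PathEdge-closed⁻ p (avoid dis p#s x∈) (avoid dis p#s y∈) q₁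
    edge⁻ []      (_ ∷ _)  dis _   p#s′ _  (q₁ , q₂) with PathEdge-closed-∈ q₁
    ... | x∈ , y∈ = PathEdge-closed⁻ p (avoid (dis ∘ swap) p#s′ x∈) (avoid (dis ∘ swap) p#s′ y∈) q₂

  -- One link suffices, except when both ears are empty: then the lists agree and the chain is
  -- empty.
  theta : ∀ p s s′ → 2 ≤ length p → Circuit (p ++ s) → Circuit (p ++ s′) → Disjoint s s′ →
    Star Linking (length (p ++ s)) (length (p ++ s′))
  theta (b ∷ p) []         []         _  _ _ _   = ε
  theta (b ∷ p) []         s′@(_ ∷ _) lp c d dis =
    (toCycle c , toCycle d , refl , refl , ears-intersect [] s′ lp c d dis λ ()) ◅ ε
  theta (b ∷ p) s@(_ ∷ _)  s′         lp c d dis =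
    (toCycle c , toCycle d , refl , refl , ears-intersect s s′ lp c d dis λ ()) ◅ ε

  -- The second circuit is followed through `p ++ s′` up to `b`, the first one from `b` back to the
  -- common start. The two vertices of `p` together with `b` already give length 3.
  splice : ∀ p {s s′ b t t′} → 2 ≤ length p →
    Circuit ((p ++ s) ++ b ∷ t) → Circuit ((p ++ s′) ++ b ∷ t′) → Disjoint s′ (b ∷ t) →
    Circuit ((p ++ s′) ++ b ∷ t)
  splice p@(x ∷ p₀) {s} {s′} {b} {t} lp (circuit cw ce cu _) (circuit dw de du _) dis
    with walk-++⁻ x (p₀ ++ s) cw | walk-++⁻ x (p₀ ++ s′) dw
       | Unique-++⁻ (p ++ s) cu | Unique-++⁻ (p ++ s′) du
  ... | _ , _ , _ , r | _ , q , e , _ | _ , ut , ps#t | ups′ , _ , _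
    with refl ← walk-head cw | refl ← walk-head q =
    circuit (walk-++⁺ q e r) ce (Unique.++⁺ ups′ ut ps′#t) (begin
      3                                     ≤⟨ +-mono-≤ lp (s≤s z≤n) ⟩
      length p + length (b ∷ t)             ≤⟨ +-monoˡ-≤ (length (b ∷ t)) (length-++-≤ˡ p) ⟩
      length (p ++ s′) + length (b ∷ t)     ≡⟨ length-++ (p ++ s′) ⟨
      length ((p ++ s′) ++ b ∷ t)           ∎)
    where
    open ≤-Reasoning
    ps′#t : Disjoint (p ++ s′) (b ∷ t)
    ps′#t (v∈ , v∈t) with ∈-++⁻ p v∈
    ... | inj₁ v∈p = ps#t (∈-++⁺ˡ v∈p , v∈t)
    ... | inj₂ v∈s′ = dis (v∈s′ , v∈t)

  -- Induction on the length of `q′`, the part of the second circuit not yet matched.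
  common-prefix : ∀ p q q′ → Acc _<_ (length q′) → 2 ≤ length p → Circuit (p ++ q) → Circuit (p ++ q′) →
    Star Linking (length (p ++ q)) (length (p ++ q′))
  common-prefix p q q′ (acc rec) lp c d with firstCommon q′ q
  ... | none dis = theta p q q′ lp c d (dis ∘ swap)
  ... | first s′ b t′ refl dis b∈ with ∈-∃++ b∈
  ... | s , t , refl =
    -- The rerouted circuit `m` runs through `p`, `s′`, `b`, `t`. Up to rotation it shares the path
    -- `b ∷ t ++ p` with the first circuit, and the ears are `s` and `s′`.
    subst₂ (Star Linking) (len-rotated s t) (len-rotated s′ t)
      (theta (b ∷ t ++ p) s s′ (≤-trans lp (length-++-≤ʳ p {b ∷ t})) (rotated s t c′) (rotated s′ t m)
        λ (v∈s , v∈s′) → dis (v∈s′ , ∈-++⁺ˡ v∈s))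
    -- With the second circuit `m` shares the longer prefix up to `b`, which leaves only `t′` to
    -- match.
    ◅◅ subst₂ (Star Linking) (len-assoc s′ t) (len-assoc s′ t′)
      (common-prefix ((p ++ s′) ++ [ b ]) t t′ (rec shorter)
        (≤-trans lp (≤-trans (length-++-≤ˡ p) (length-++-≤ˡ (p ++ s′))))
        (subst Circuit (sym (++-assoc (p ++ s′) [ b ] t)) m)
        (subst Circuit (sym (++-assoc (p ++ s′) [ b ] t′)) d′))
    where
    c′ = subst Circuit (sym (++-assoc p s (b ∷ t))) c
    d′ = subst Circuit (sym (++-assoc p s′ (b ∷ t′))) d
    m = splice p lp c′ d′ (λ (v∈s′ , v∈t) → dis (v∈s′ , ∈-++⁺ʳ s v∈t))

    rotated : ∀ r u → Circuit ((p ++ r) ++ b ∷ u) → Circuit ((b ∷ u ++ p) ++ r)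
    rotated r u k = subst Circuit (sym (++-assoc (b ∷ u) p r)) (rotate (p ++ r) (b ∷ u) k)

    len-rotated : ∀ r u → length ((b ∷ u ++ p) ++ r) ≡ length (p ++ r ++ b ∷ u)
    len-rotated r u = begin
      length ((b ∷ u ++ p) ++ r)  ≡⟨ cong length (++-assoc (b ∷ u) p r) ⟩
      length (b ∷ u ++ p ++ r)    ≡⟨ length-++-comm (b ∷ u) (p ++ r) ⟩
      length ((p ++ r) ++ b ∷ u)  ≡⟨ cong length (++-assoc p r (b ∷ u)) ⟩
      length (p ++ r ++ b ∷ u)    ∎
      where open ≡-Reasoning

    len-assoc : ∀ r u → length (((p ++ r) ++ [ b ]) ++ u) ≡ length (p ++ r ++ b ∷ u)
    len-assoc r u = cong length (trans (++-assoc (p ++ r) [ b ] u) (++-assoc p r (b ∷ u)))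

    shorter : length t′ < length (s′ ++ b ∷ t′)
    shorter = length-++-≤ʳ (b ∷ t′) {s′}

  common-edge : ∀ {v x xs ys} → Circuit (v ∷ x ∷ xs) → Circuit (v ∷ x ∷ ys) →
    Star Linking (length (v ∷ x ∷ xs)) (length (v ∷ x ∷ ys))
  common-edge {v} {x} {xs} {ys} = common-prefix (v ∷ x ∷ []) xs ys (<-wellFounded _) (s≤s (s≤s z≤n))

  first-edge : ∀ {v x xs} → Circuit (v ∷ x ∷ xs) → E G v x
  first-edge (circuit (step e p) _ _ _) with refl ← walk-head p = e

  close : ∀ {v x y ps} → E G v x → E G v y → x ≢ y → Walk G x y ps → Unique ps → v ∉ ps → Circuit (v ∷ ps)
  close e f x≢y stay         u v∉ = contradiction refl x≢y
  close e f x≢y p@(step _ q) u v∉ =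
    circuit (step e p) (E-sym f) (¬Any⇒All¬ _ v∉ ∷ u) (s≤s (s≤s (walk-nonempty q)))

  -- Joining arbitrary cycles in a 2-connected graph.

  module _ (2-conn : TwoConnected G) where

    -- A simple path from `x` to `y` avoiding `v` closes up through `v`. The same cycle is given in
    -- both directions, so that either edge at `v` can come first, as `common-edge` expects.
    bypass : ∀ {v x y} → E G v x → E G v y → x ≢ y →
      ∃₂ λ xs ys → Circuit (v ∷ x ∷ xs) × Circuit (v ∷ y ∷ ys) × length (v ∷ x ∷ xs) ≡ length (v ∷ y ∷ ys)
    bypass {v} {x} {y} e f x≢y with proj₂ (proj₂ 2-conn) v x y (E⇒≢ e) (E⇒≢ f)
    ... | _ , w , ≢v with simplePath w
    ... | ps , p , u , ps⊆ with walk-∷ p | walk-∷ (walk-reverse p)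
    ... | xs , refl | ys , eq = xs , ys
      , close e f x≢y p u v∉
      , subst (Circuit ∘ (v ∷_)) eq (close f e (x≢y ∘ sym) (walk-reverse p)
          (Unique-resp-↭ (↭-sym (↭-reverse (x ∷ xs))) u) (v∉ ∘ ∈-resp-↭ (↭-reverse (x ∷ xs))))
      , cong suc (trans (sym (length-reverse (x ∷ xs))) (cong length eq))
      where
      v∉ : v ∉ ps
      v∉ v∈ = All.lookup ≢v (ps⊆ v∈) refl

    common-vertex : ∀ {v xs ys} → Circuit (v ∷ xs) → Circuit (v ∷ ys) →
      Star Linking (length (v ∷ xs)) (length (v ∷ ys))
    common-vertex {xs = []} (circuit _ _ _ (s≤s ())) _
    common-vertex {xs = _ ∷ _} {ys = []} _ (circuit _ _ _ (s≤s ()))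
    common-vertex {xs = x ∷ _} {ys = y ∷ _} c d with x ≟ y
    ... | yes refl = common-edge c d
    ... | no x≢y with bypass (first-edge c) (first-edge d) x≢y
    ... | _ , _ , k , k′ , eq = subst (Star Linking _) eq (common-edge c k) ◅◅ common-edge k′ d

    -- Induction on the walk, carrying a circuit through its current vertex.
    along-walk : ∀ {u w ws xs ys} → Walk G u w ws → Circuit xs → u ∈ xs → Circuit ys → w ∈ ys →
      Star Linking (length xs) (length ys)
    along-walk stay c u∈ d w∈ with rotateTo c u∈ | rotateTo d w∈
    ... | _ , c′ , xs↭ | _ , d′ , ys↭ =
      subst₂ (Star Linking) (sym (↭-length xs↭)) (sym (↭-length ys↭)) (common-vertex c′ d′)
    along-walk (step {y = y} e p) c u∈ d w∈ with rotateTo c u∈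
    ... | [] , circuit _ _ _ (s≤s ()) , _
    ... | x ∷ _ , c′ , xs↭ with x ≟ y
    ... | yes refl = along-walk p c (∈-resp-↭ (↭-sym xs↭) (there (here refl))) d w∈
    -- The circuit is exchanged for one that contains the next edge of the walk and hence its far
    -- end `y`.
    ... | no x≢y with bypass (first-edge c′) e x≢y
    ... | _ , _ , _ , k , _ =
      subst (λ l → Star Linking l _) (sym (↭-length xs↭)) (common-vertex c′ k)
      ◅◅ along-walk p k (there (here refl)) d w∈

    cycles-linked : (c d : Cycle G) → Star Linking (len G c) (len G d)
    cycles-linked c d with proj₁ (proj₂ 2-conn) (Cycle.v₀ c) (Cycle.v₀ d)
    ... | _ , w = along-walk w (fromCycle c) (here refl) (fromCycle d) (here refl)

  -- The link at which the type changes.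

  type-change : ∀ {i j : Fin 4} → i ≢ j → (∀ c → HasType {G = G} i c ⊎ HasType j c) →
    ∀ {k l} → Star Linking k l → k % 4 ≡ toℕ i → l % 4 ≡ toℕ j →
    Σ (Cycle G) λ c → Σ (Cycle G) λ d → HasType i c × HasType j d × Intersect c d
  type-change i≢j types ε ki lj = contradiction (toℕ-injective (trans (sym ki) lj)) i≢j
  type-change i≢j types ((c , d , refl , refl , c∩d) ◅ chain) ki lj with types d
  -- The length at the start of the remaining chain stays of type `i`; since the chain ends in type
  -- `j`, some link must leave type `i`.
  ... | inj₁ di = type-change i≢j types chain di lj
  ... | inj₂ dj = c , d , ki , dj , c∩d

theorem2 : (i j : Fin 4) → i ≢ j → (n : ℕ) → (G : Graph n) →
    InEps i j G → TwoConnected G →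
    Σ (Cycle G) λ c → Σ (Cycle G) λ d → HasType i c × HasType j d × Intersect c d
theorem2 i j i≢j n G (_ , types , (c , ci) , (d , dj)) 2-conn =
  type-change G i≢j types (cycles-linked G 2-conn c d) ci dj
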